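{- $L(n)=\Omega((c_l n)^n)$ with $c_l=0.76$; that is, there is a constant $c>0$ such that $L(n)\ge c\,(0.76\,n)^n$ for all $n>1$.
   Context: For $n>1$ let $S'_n$ be a set of $n-1$ elements. For $1\le m<n$, a $Q(m)$-ranking is a function $h:S'_n\to\{0,1,\dots,2m-1\}$ such that every odd number $1,3,\dots,2m-1$ is a value of $h$; $L(n,m)$ is the number of $Q(m)$-rankings and $L(n)=\max_{1\le m<n}L(n,m)$. -}

module Defs where

open import Data.Nat using (ℕ; zero; suc; _+_; _*_; _∸_; _⊔_; _≟_)
open import Data.Fin using (Fin; toℕ)
open import Data.Fin.Properties using (all?; any?)
open import Data.Vec using (Vec; []; _∷_; lookup)
open import Data.List using (List; [_]; map; concatMap; length; filter; foldr; drop; upTo; allFin)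
open import Data.Product using (∃)
open import Relation.Binary.PropositionalEquality using (_≡_)
open import Relation.Nullary using (Dec)

-- All vectors of length n over Fin k, i.e. all functions Fin n → Fin k
-- (a vector v represents the function i ↦ lookup v i).
allVecs : (k n : ℕ) → List (Vec (Fin k) n)
allVecs k zero    = [ [] ]
allVecs k (suc n) = concatMap (λ v → map (_∷ v) (allFin k)) (allVecs k n)

-- h : S'_n → {0,…,2m-1} with S'_n = Fin (n ∸ 1); Q(m)-ranking condition:
-- every odd number 2j+1 (j < m) is a value of h.
IsQRanking : (m : ℕ) {s : ℕ} → Vec (Fin (2 * m)) s → Set
IsQRanking m {s} h = (j : Fin m) → ∃ λ (i : Fin s) → toℕ (lookup h i) ≡ suc (2 * toℕ j)

isQRanking? : (m : ℕ) {s : ℕ} (h : Vec (Fin (2 * m)) s) → Dec (IsQRanking m h)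
isQRanking? m {s} h = all? λ j → any? λ i → toℕ (lookup h i) ≟ suc (2 * toℕ j)

L₂ : ℕ → ℕ → ℕ
L₂ n m = length (filter (isQRanking? m) (allVecs (2 * m) (n ∸ 1)))

L : ℕ → ℕ
L n = foldr _⊔_ 0 (map (L₂ n) (drop 1 (upTo n)))

{-# OPTIONS --safe #-}
module Submission where

-- Pairing the values 2i and 2i + 1 shows that the numbers of Q(m)-rankings of an n-set have the
-- exponential generating function vᵐ with v = (eˣ - 1) eˣ. Their sum over m has 1 / (1 - v),
-- whose dominant pole is x = ln φ (φ the golden ratio), so it grows like n! / (ln φ)ⁿ, and the maximum
-- over m loses at most a factor n. By Stirling this is about (n / (e ln φ))ⁿ, where
-- 1 / (e ln φ) = 0.7644… > 0.76. The gap leaves room for elementary estimates: already the fifth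
-- Taylor polynomial of v exceeds 1 at x = 14/29, and 29/14 > 0.76 e makes n! (29/14)ⁿ absorb
-- n (0.76 n)ⁿ, because (1 + 1/n)ⁿ⁺² decreases and falls below 29 / (14 · 0.76) by n = 601.

open import Defs
open import Data.Nat using (ℕ; zero; suc; pred; _+_; _*_; _∸_; _^_; _!; _≤_; _<_; z≤n; s≤s; s≤s⁻¹; _⊔_; NonZero; >-nonZero)
open import Data.Nat.Combinatorics
open import Data.Nat.DivMod using (m/n*n≡m)
open import Data.Nat.Divisibility using (_∣_)
open import Data.Nat.Properties
open import Data.Nat.Tactic.RingSolver using (solve-∀)
open import Data.Nat.Induction using (<-rec)
open import Data.Bool using (Bool; not)
open import Data.Fin using (Fin; zero; suc; toℕ; fromℕ<)
open import Data.Fin.Properties using (toℕ-fromℕ<; toℕ<n) renaming (_≟_ to _≟ᶠ_)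
open import Data.Fin.Subset using (Subset; inside; outside; _∈_; ∁; ∣_∣)
open import Data.Fin.Subset.Properties using (x∈p⇒∣p-x∣<∣p∣)
open import Data.List using ([]; _∷_; _++_; map; concatMap; length; filter; foldr; allFin; tabulate)
open import Data.List.Membership.Propositional renaming (_∈_ to _∈ˡ_) using ()
open import Data.List.Membership.Propositional.Properties using (∈-applyUpTo⁺; ∈-map⁺)
open import Data.List.Properties using (filter-++; length-++; map-tabulate)
open import Data.List.Relation.Unary.Any using (here; there)
open import Data.Nat.ListAction using (sum)
open import Data.Product using (Σ; ∃; _×_; _,_; proj₁; proj₂)
open import Data.Unit using (tt)
open import Data.Vec using (Vec; []; _∷_; lookup; here; there; _[_]≔_)
open import Data.Vec.Properties using ([]≔-minimal)
open import Function using (_∘_)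
open import Relation.Binary.PropositionalEquality
open import Relation.Nullary using (Dec; yes; no; contradiction)

-- Finite sums

∑ : ℕ → (ℕ → ℕ) → ℕ
∑ zero    f = 0
∑ (suc n) f = f 0 + ∑ n (f ∘ suc)

∑-mono : ∀ n {f g} → (∀ i → i < n → f i ≤ g i) → ∑ n f ≤ ∑ n g
∑-mono zero    f≤g = z≤n
∑-mono (suc n) f≤g = +-mono-≤ (f≤g 0 (s≤s z≤n)) (∑-mono n λ i i<n → f≤g (suc i) (s≤s i<n))

∑-cong : ∀ n {f g} → (∀ i → f i ≡ g i) → ∑ n f ≡ ∑ n g
∑-cong zero    f≡g = refl
∑-cong (suc n) f≡g = cong₂ _+_ (f≡g 0) (∑-cong n (f≡g ∘ suc))

∑-zero : ∀ n → ∑ n (λ _ → 0) ≡ 0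
∑-zero zero    = refl
∑-zero (suc n) = ∑-zero n

∑-monoˡ-suc : ∀ n f → ∑ n f ≤ ∑ (suc n) f
∑-monoˡ-suc zero    f = z≤n
∑-monoˡ-suc (suc n) f = +-monoʳ-≤ (f 0) (∑-monoˡ-suc n (f ∘ suc))

∑-distrib-+ : ∀ n f g → ∑ n (λ i → f i + g i) ≡ ∑ n f + ∑ n g
∑-distrib-+ zero    f g = refl
∑-distrib-+ (suc n) f g = trans (cong (f 0 + g 0 +_) (∑-distrib-+ n (f ∘ suc) (g ∘ suc)))
  (ring (f 0) (g 0) (∑ n (f ∘ suc)) (∑ n (g ∘ suc)))
  where
  ring : ∀ a b c d → a + b + (c + d) ≡ a + c + (b + d)
  ring = solve-∀

*-distribˡ-∑ : ∀ n a f → a * ∑ n f ≡ ∑ n (λ i → a * f i)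
*-distribˡ-∑ zero    a f = *-zeroʳ a
*-distribˡ-∑ (suc n) a f = trans (*-distribˡ-+ a (f 0) _) (cong (a * f 0 +_) (*-distribˡ-∑ n a (f ∘ suc)))

-- Binomial convolution

nCk*k!*[n∸k]!≡n! : ∀ {n k} → k ≤ n → (n C k) * (k ! * (n ∸ k) !) ≡ n !
nCk*k!*[n∸k]!≡n! {n} {k} k≤n = trans (cong (_* (k ! * (n ∸ k) !)) (nCk≡n!/k![n-k]! k≤n))
  (m/n*n≡m (subst (_∣ n !) (*-comm ((n ∸ k) !) (k !)) ([n∸k]!k!∣n! k≤n)))
  where instance _ = k !* (n ∸ k) !≢0

-- The sum is cut off at K; the terms with k > n vanish because n C k does, whatever n ∸ k is.
conv : ℕ → (ℕ → ℕ) → (ℕ → ℕ) → ℕ → ℕ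
conv K f g n = ∑ K λ k → (n C k) * (f k * g (n ∸ k))

conv-linearˡ : ∀ K a b f f′ g n →
  conv K (λ k → a * f k + b * f′ k) g n ≡ a * conv K f g n + b * conv K f′ g n
conv-linearˡ K a b f f′ g n = trans
  (∑-cong K λ k → ring a b (n C k) (f k) (f′ k) (g (n ∸ k)))
  (trans (∑-distrib-+ K _ _) (sym (cong₂ _+_ (*-distribˡ-∑ K a _) (*-distribˡ-∑ K b _))))
  where
  ring : ∀ a b c x y z → c * ((a * x + b * y) * z) ≡ a * (c * (x * z)) + b * (c * (y * z))
  ring = solve-∀

conv-linearʳ : ∀ K a b f g g′ n →
  conv K f (λ k → a * g k + b * g′ k) n ≡ a * conv K f g n + b * conv K f g′ n
conv-linearʳ K a b f g g′ n = trans
  (∑-cong K λ k → ring a b (n C k) (f k) (g (n ∸ k)) (g′ (n ∸ k)))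
  (trans (∑-distrib-+ K _ _) (sym (cong₂ _+_ (*-distribˡ-∑ K a _) (*-distribˡ-∑ K b _))))
  where
  ring : ∀ a b c z x y → c * (z * (a * x + b * y)) ≡ a * (c * (z * x)) + b * (c * (z * y))
  ring = solve-∀

∑-conv : ∀ M K f (g : ℕ → ℕ → ℕ) n →
  ∑ M (λ m → conv K f (g m) n) ≡ conv K f (λ i → ∑ M λ m → g m i) n
∑-conv zero    K f g n = sym (trans (∑-cong K λ k → trans (cong ((n C k) *_) (*-zeroʳ (f k))) (*-zeroʳ (n C k))) (∑-zero K))
∑-conv (suc M) K f g n = begin
  conv K f (g 0) n + ∑ M (λ m → conv K f (g (suc m)) n)
    ≡⟨ cong (conv K f (g 0) n +_) (∑-conv M K f (g ∘ suc) n) ⟩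
  conv K f (g 0) n + conv K f G n
    ≡⟨ cong₂ _+_ (*-identityˡ (conv K f (g 0) n)) (*-identityˡ (conv K f G n)) ⟨
  1 * conv K f (g 0) n + 1 * conv K f G n
    ≡⟨ conv-linearʳ K 1 1 f (g 0) G n ⟨
  conv K f (λ k → 1 * g 0 k + 1 * G k) n
    ≡⟨ ∑-cong K (λ k → cong (λ x → (n C k) * (f k * x)) (cong₂ _+_ (*-identityˡ (g 0 (n ∸ k))) (*-identityˡ _))) ⟩
  conv K f (λ k → g 0 k + G k) n ∎
  where
  open ≡-Reasoning
  G : ℕ → ℕ
  G i = ∑ M λ m → g (suc m) i

-- The shift acts as a derivation, by Pascal's rule.
conv-suc : ∀ K f g n → conv K f g (suc n) ≤ conv K (f ∘ suc) g n + conv K f (g ∘ suc) n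
conv-suc zero    f g n = z≤n
conv-suc (suc K) f g n = begin
  (suc n C 0) * x₀ + ∑ K (λ k → (suc n C suc k) * (f (suc k) * g (n ∸ k)))
    ≡⟨ cong₂ _+_ (cong (_* x₀) (trans (nC0≡1 (suc n)) (sym (nC0≡1 n)))) (∑-cong K pascal) ⟩
  y₀ + ∑ K (λ k → s k + t k)            ≡⟨ cong (y₀ +_) (∑-distrib-+ K s t) ⟩
  y₀ + (∑ K s + ∑ K t)                  ≡⟨ ring y₀ (∑ K s) (∑ K t) ⟩
  -- The only loss is the last term `s K`, which vanishes when `n < K`.
  ∑ K s + (y₀ + ∑ K t)                  ≤⟨ +-monoˡ-≤ _ (∑-monoˡ-suc K s) ⟩
  ∑ (suc K) s + (y₀ + ∑ K t)            ∎
  where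
  open ≤-Reasoning
  x₀ y₀ : ℕ
  x₀ = f 0 * g (suc n)
  y₀ = (n C 0) * x₀
  s t : ℕ → ℕ
  s k = (n C k) * (f (suc k) * g (n ∸ k))
  t k = (n C suc k) * (f (suc k) * g (suc (n ∸ suc k)))
  nC0≡1 : ∀ n → n C 0 ≡ 1
  nC0≡1 n = trans (nCk≡nC[n∸k] {0} {n} z≤n) (nCn≡1 n)
  ring : ∀ a b c → a + (b + c) ≡ b + (a + c)
  ring = solve-∀
  -- `suc (n ∸ suc k)` is `n ∸ k` only for `k < n`; beyond that `n C suc k` is 0.
  reindex : ∀ k → (n C suc k) * (f (suc k) * g (n ∸ k)) ≡ t k
  reindex k with k <? n
  ... | yes k<n = cong (λ j → (n C suc k) * (f (suc k) * g j)) (+-∸-assoc 1 k<n)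
  ... | no  k≮n rewrite k>n⇒nCk≡0 {n} {suc k} (s≤s (≮⇒≥ k≮n)) = refl
  pascal : ∀ k → (suc n C suc k) * (f (suc k) * g (n ∸ k)) ≡ s k + t k
  pascal k = trans (cong (_* (f (suc k) * g (n ∸ k))) (sym (nCk+nC[k+1]≡[n+1]C[k+1] n k)))
    (trans (*-distribʳ-+ (f (suc k) * g (n ∸ k)) (n C k) (n C suc k)) (cong (s k +_) (reindex k)))

-- Covering words

-- The number of words of length n, over an alphabet of f free and j obligatory letters,
-- in which every obligatory letter occurs; as a sequence in n it has the
-- exponential generating function (eˣ - 1)ʲ eᶠˣ.
covering : ℕ → ℕ → ℕ → ℕ
covering f j zero    = 0 ^ j
covering f j (suc n) = j * covering (suc f) (pred j) n + f * covering f j n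

-- Multiplying (eˣ - 1)ⁱ eˢˣ by (eˣ - 1)ʲ eᶠˣ adds the exponents. Up to terms lost to the cut-off,
-- `conv-suc` gives the convolution the very recurrence that defines `covering`, so induction on `n`
-- applies.
conv-covering-≤ : ∀ K s i f j n → conv K (covering s i) (covering f j) n ≤ covering (s + f) (i + j) n
conv-covering-≤ zero    s i f j n    = z≤n
conv-covering-≤ (suc K) s i f j zero = ≤-reflexive (begin
  0 ^ i * 0 ^ j + 0 + ∑ K (λ k → 0 * (covering s i (suc k) * 0 ^ j))
    ≡⟨ cong (0 ^ i * 0 ^ j + 0 +_) (∑-zero K) ⟩
  0 ^ i * 0 ^ j + 0 + 0   ≡⟨ trans (+-identityʳ _) (+-identityʳ _) ⟩
  0 ^ i * 0 ^ j           ≡⟨ ^-distribˡ-+-* 0 i j ⟨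
  0 ^ (i + j)             ∎)
  where open ≡-Reasoning
conv-covering-≤ K@(suc _) s i f j (suc n) = begin
  conv K (covering s i) (covering f j) (suc n)
    ≤⟨ conv-suc K (covering s i) (covering f j) n ⟩
  conv K (covering s i ∘ suc) (covering f j) n + conv K (covering s i) (covering f j ∘ suc) n
    ≡⟨ cong₂ _+_ (conv-linearˡ K i s (covering (suc s) (pred i)) (covering s i) (covering f j) n)
                 (conv-linearʳ K j f (covering s i) (covering (suc f) (pred j)) (covering f j) n) ⟩
  (i * conv K (covering (suc s) (pred i)) (covering f j) n + s * conv K (covering s i) (covering f j) n) +
  (j * conv K (covering s i) (covering (suc f) (pred j)) n + f * conv K (covering s i) (covering f j) n)
    ≤⟨ +-mono-≤ (+-mono-≤ (first i) (*-monoʳ-≤ s rec)) (+-mono-≤ (second j) (*-monoʳ-≤ f rec)) ⟩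
  (i * c + s * d) + (j * c + f * d)
    ≡⟨ ring i s j f c d ⟩
  (i + j) * c + (s + f) * d ∎
  where
  open ≤-Reasoning
  c d : ℕ
  c = covering (suc (s + f)) (pred (i + j)) n
  d = covering (s + f) (i + j) n
  rec : conv K (covering s i) (covering f j) n ≤ d
  rec = conv-covering-≤ K s i f j n
  -- For `i = 0` the index `pred (i + j)` does not match `pred i` and `j`, but then the factor `i`
  -- kills the term; likewise for `j` in `second`.
  first : ∀ i → i * conv K (covering (suc s) (pred i)) (covering f j) n ≤ i * covering (suc (s + f)) (pred (i + j)) n
  first zero    = z≤n
  first (suc i) = *-monoʳ-≤ (suc i) (conv-covering-≤ K (suc s) i f j n)
  second : ∀ j → j * conv K (covering s i) (covering (suc f) (pred j)) n ≤ j * covering (suc (s + f)) (pred (i + j)) n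
  second zero    = z≤n
  second (suc j) rewrite +-suc i j | sym (+-suc s f) = *-monoʳ-≤ (suc j) (conv-covering-≤ K s i (suc f) j n)
  ring : ∀ i s j f c d → (i * c + s * d) + (j * c + f * d) ≡ (i + j) * c + (s + f) * d
  ring = solve-∀

-- The sum over m and its growth

∑-covering : ℕ → ℕ → ℕ
∑-covering M n = ∑ M λ m → covering m m n

-- The coefficient form of 1 / (1 - v) = 1 + v / (1 - v) for v = (eˣ - 1) eˣ.
conv-∑-covering-≤ : ∀ K M n → conv K (covering 1 1) (∑-covering M) n ≤ ∑-covering (suc M) n
conv-∑-covering-≤ K M n = begin
  conv K (covering 1 1) (∑-covering M) n
    ≡⟨ ∑-conv M K (covering 1 1) (λ m → covering m m) n ⟨
  ∑ M (λ m → conv K (covering 1 1) (covering m m) n)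
    ≤⟨ ∑-mono M (λ m _ → conv-covering-≤ K 1 1 m m n) ⟩
  ∑ M (λ m → covering (suc m) (suc m) n)
    ≤⟨ m≤n+m _ _ ⟩
  ∑-covering (suc M) n ∎
  where open ≤-Reasoning

-- Coefficientwise v is at least x, so 1 / (1 - v) is at least 1 / (1 - x), whose coefficients are
-- the factorials. This starts the induction in `∑-covering-growth`.
!-≤-∑-covering : ∀ {n M} → n < M → n ! ≤ ∑-covering M n
!-≤-∑-covering {zero}  {suc M} _         = s≤s z≤n
!-≤-∑-covering {suc n} {suc M} (s≤s n<M) = begin
  suc n * n !
    ≤⟨ *-monoʳ-≤ (suc n) (!-≤-∑-covering n<M) ⟩
  suc n * ∑-covering M n
    ≡⟨ cong₂ _*_ (nC1≡n (suc n)) (*-identityˡ (∑-covering M n)) ⟨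
  -- The cut-off 2 keeps k = 0, where `covering 1 1 0` is 0, and k = 1, where `covering 1 1 1` is 1.
  (suc n C 1) * (1 * ∑-covering M n)
    ≤⟨ ≤-trans (m≤m+n _ 0) (m≤n+m _ ((suc n C 0) * (0 * ∑-covering M (suc n)))) ⟩
  conv 2 (covering 1 1) (∑-covering M) (suc n)
    ≤⟨ conv-∑-covering-≤ 2 M (suc n) ⟩
  ∑-covering (suc M) (suc n) ∎
  where open ≤-Reasoning

-- K! pᴷ times the k-th term of the series of (eˣ - 1) eˣ at x = q / p.
scaledTerm : ℕ → ℕ → ℕ → ℕ → ℕ
scaledTerm p q K k = (K C k) * (K ∸ k) ! * (q ^ k * p ^ (K ∸ k)) * covering 1 1 k

-- The hypothesis on the sum says that the K-th Taylor polynomial of (eˣ - 1) eˣ is at least 1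
-- at x = q / p.
∑-covering-growth : ∀ p q K .{{_ : NonZero p}} .{{_ : NonZero q}} →
  K ! * p ^ K ≤ ∑ (suc K) (scaledTerm p q K) →
  ∀ n {M} → n < M → p ^ n * n ! ≤ p ^ K * (q ^ n * ∑-covering M n)
∑-covering-growth p q K series≥1 = <-rec _ step
  where
  open ≤-Reasoning
  step : ∀ n → (∀ {i} → i < n → ∀ {M} → i < M → p ^ i * i ! ≤ p ^ K * (q ^ i * ∑-covering M i)) →
    ∀ {M} → n < M → p ^ n * n ! ≤ p ^ K * (q ^ n * ∑-covering M n)
  step n rec {suc M} n<M with n ≤? K
  -- For small `n` the spare factor `p ^ K` pays for `p ^ n`.
  ... | yes n≤K = *-mono-≤ (^-monoʳ-≤ p n≤K)
    (≤-trans (!-≤-∑-covering n<M) (m≤n*m _ (q ^ n) {{m^n≢0 q n}}))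
  ... | no n≰K = *-cancelˡ-≤ (K !) {{K !≢0}} (begin
    K ! * (p ^ n * n !)
      ≡⟨ cong (λ x → K ! * (x * n !)) (trans (cong (p ^_) (sym (m+[n∸m]≡n K≤n))) (^-distribˡ-+-* p K (n ∸ K))) ⟩
    K ! * (p ^ K * p ^ (n ∸ K) * n !)
      ≡⟨ ring₁ (K !) (p ^ K) (p ^ (n ∸ K)) (n !) ⟩
    p ^ (n ∸ K) * n ! * (K ! * p ^ K)
      -- Replacing `K ! * p ^ K` by the Taylor sum splits the claim into terms, the k-th of which
      -- follows from the induction hypothesis at `n ∸ k`.
      ≤⟨ *-monoʳ-≤ (p ^ (n ∸ K) * n !) series≥1 ⟩
    p ^ (n ∸ K) * n ! * ∑ (suc K) (scaledTerm p q K)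
      ≡⟨ *-distribˡ-∑ (suc K) (p ^ (n ∸ K) * n !) (scaledTerm p q K) ⟩
    ∑ (suc K) (λ k → p ^ (n ∸ K) * n ! * scaledTerm p q K k)
      ≤⟨ ∑-mono (suc K) (λ { k (s≤s k≤K) → term k k≤K }) ⟩
    ∑ (suc K) (λ k → K ! * p ^ K * q ^ n * ((n C k) * (covering 1 1 k * ∑-covering M (n ∸ k))))
      ≡⟨ *-distribˡ-∑ (suc K) (K ! * p ^ K * q ^ n) (λ k → (n C k) * (covering 1 1 k * ∑-covering M (n ∸ k))) ⟨
    K ! * p ^ K * q ^ n * conv (suc K) (covering 1 1) (∑-covering M) n
      ≤⟨ *-monoʳ-≤ (K ! * p ^ K * q ^ n) (conv-∑-covering-≤ (suc K) M n) ⟩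
    K ! * p ^ K * q ^ n * ∑-covering (suc M) n
      ≡⟨ ring₂ (K !) (p ^ K) (q ^ n) (∑-covering (suc M) n) ⟩
    K ! * (p ^ K * (q ^ n * ∑-covering (suc M) n)) ∎)
    where
    K≤n : K ≤ n
    K≤n = <⇒≤ (≰⇒> n≰K)
    ring₁ : ∀ a b c d → a * (b * c * d) ≡ c * d * (a * b)
    ring₁ = solve-∀
    ring₂ : ∀ a b c d → a * b * c * d ≡ a * (b * (c * d))
    ring₂ = solve-∀
    ring₃ : ∀ a b c d e f g h x → a * (b * (c * d)) * (e * f * (g * h) * x) ≡ e * (c * f) * (b * x * g) * (a * h * d)
    ring₃ = solve-∀
    ring₄ : ∀ a b x c d e y → a * (b * x * c) * (d * (e * y)) ≡ a * d * (c * e) * (b * (x * y))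
    ring₄ = solve-∀
    term : ∀ k → k ≤ K → p ^ (n ∸ K) * n ! * scaledTerm p q K k
      ≤ K ! * p ^ K * q ^ n * ((n C k) * (covering 1 1 k * ∑-covering M (n ∸ k)))
    -- There is no induction hypothesis for k = 0, but v has no constant term.
    term zero    _ = ≤-trans (≤-reflexive (trans (cong (p ^ (n ∸ K) * n ! *_) (*-zeroʳ ((K C 0) * K ! * (1 * p ^ K))))
                                                 (*-zeroʳ (p ^ (n ∸ K) * n !)))) z≤n
    term k@(suc _) k≤K = begin
      p ^ (n ∸ K) * n ! * scaledTerm p q K k
        ≡⟨ cong (λ x → p ^ (n ∸ K) * x * scaledTerm p q K k) (nCk*k!*[n∸k]!≡n! k≤n) ⟨
      p ^ (n ∸ K) * ((n C k) * (k ! * (n ∸ k) !)) * scaledTerm p q K k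
        ≡⟨ ring₃ (p ^ (n ∸ K)) (n C k) (k !) ((n ∸ k) !) (K C k) ((K ∸ k) !) (q ^ k) (p ^ (K ∸ k)) v ⟩
      (K C k) * (k ! * (K ∸ k) !) * ((n C k) * v * q ^ k) * (p ^ (n ∸ K) * p ^ (K ∸ k) * (n ∸ k) !)
        ≡⟨ cong₂ (λ x y → x * ((n C k) * v * q ^ k) * (y * (n ∸ k) !)) (nCk*k!*[n∸k]!≡n! k≤K)
             (trans (sym (^-distribˡ-+-* p (n ∸ K) (K ∸ k))) (cong (p ^_) ([n∸K]+[K∸k])) ) ⟩
      K ! * ((n C k) * v * q ^ k) * (p ^ (n ∸ k) * (n ∸ k) !)
        ≤⟨ *-monoʳ-≤ (K ! * ((n C k) * v * q ^ k)) (rec n∸k<n (<-≤-trans n∸k<n (s≤s⁻¹ n<M))) ⟩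
      K ! * ((n C k) * v * q ^ k) * (p ^ K * (q ^ (n ∸ k) * ∑-covering M (n ∸ k)))
        ≡⟨ ring₄ (K !) (n C k) v (q ^ k) (p ^ K) (q ^ (n ∸ k)) (∑-covering M (n ∸ k)) ⟩
      K ! * p ^ K * (q ^ k * q ^ (n ∸ k)) * ((n C k) * (v * ∑-covering M (n ∸ k)))
        ≡⟨ cong (λ x → K ! * p ^ K * x * ((n C k) * (v * ∑-covering M (n ∸ k))))
             (trans (sym (^-distribˡ-+-* q k (n ∸ k))) (cong (q ^_) (m+[n∸m]≡n k≤n))) ⟩
      K ! * p ^ K * q ^ n * ((n C k) * (v * ∑-covering M (n ∸ k))) ∎
      where
      v : ℕ
      v = covering 1 1 k
      k≤n : k ≤ n
      k≤n = ≤-trans k≤K K≤n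
      n∸k<n : n ∸ k < n
      n∸k<n = ∸-monoʳ-< (s≤s z≤n) k≤n
      [n∸K]+[K∸k] : n ∸ K + (K ∸ k) ≡ n ∸ k
      [n∸K]+[K∸k] = trans (sym (+-∸-assoc (n ∸ K) k≤K)) (cong (_∸ k) (m∸n+n≡m K≤n))

-- Powers against factorials

^-distribʳ-* : ∀ m n k → (m * n) ^ k ≡ m ^ k * n ^ k
^-distribʳ-* m n zero    = refl
^-distribʳ-* m n (suc k) = trans (cong (m * n *_) (^-distribʳ-* m n k)) ([m*n]*[o*p]≡[m*o]*[n*p] m n (m ^ k) (n ^ k))

bernoulli : ∀ a k → a ^ k * (a + k) ≤ a * suc a ^ k
bernoulli a zero    = ≤-reflexive (ring a)
  where
  ring : ∀ a → 1 * (a + 0) ≡ a * 1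
  ring = solve-∀
bernoulli a (suc k) = begin
  a * a ^ k * (a + suc k)               ≤⟨ m≤m+n _ (a ^ k * k) ⟩
  a * a ^ k * (a + suc k) + a ^ k * k   ≡⟨ ring₁ a (a ^ k) k ⟩
  suc a * (a ^ k * (a + k))             ≤⟨ *-monoʳ-≤ (suc a) (bernoulli a k) ⟩
  suc a * (a * suc a ^ k)               ≡⟨ ring₂ (suc a) a (suc a ^ k) ⟩
  a * (suc a * suc a ^ k)               ∎
  where
  open ≤-Reasoning
  ring₁ : ∀ a x k → a * x * (a + (1 + k)) + x * k ≡ (1 + a) * (x * (a + k))
  ring₁ = solve-∀
  ring₂ : ∀ b a x → b * (a * x) ≡ a * (b * x)
  ring₂ = solve-∀

-- With a = n (n + 2), so that a + 1 = (n + 1)², Bernoulli's inequality gives ((n + 1)² / a)ⁿ⁺² ≥ 1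
-- + 1/n, which exceeds (n + 2) / (n + 1).
[1+1/n]^[n+2]-decreasing : ∀ n .{{_ : NonZero n}} →
  (2 + n) ^ (3 + n) * n ^ (2 + n) ≤ (1 + n) ^ (3 + n) * (1 + n) ^ (2 + n)
[1+1/n]^[n+2]-decreasing n@(suc _) = *-cancelˡ-≤ a (begin
  a * ((2 + n) ^ (3 + n) * n ^ k)
    ≡⟨ cong (a *_) (*-assoc (2 + n) ((2 + n) ^ k) (n ^ k)) ⟩
  a * ((2 + n) * ((2 + n) ^ k * n ^ k))
    ≡⟨ cong (λ x → a * ((2 + n) * x)) (^-distribʳ-* (2 + n) n k) ⟨
  a * ((2 + n) * a ^ k)
    ≤⟨ m≤m+n _ ((2 + n) * a ^ k) ⟩
  a * ((2 + n) * a ^ k) + (2 + n) * a ^ k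
    ≡⟨ ring₁ n (a ^ k) ⟩
  (1 + n) * (a ^ k * (a + k))
    ≤⟨ *-monoʳ-≤ (1 + n) (bernoulli a k) ⟩
  (1 + n) * (a * suc a ^ k)
    ≡⟨ cong (λ x → (1 + n) * (a * x ^ k)) (ring₂ n) ⟩
  (1 + n) * (a * ((1 + n) * (1 + n)) ^ k)
    ≡⟨ cong (λ x → (1 + n) * (a * x)) (^-distribʳ-* (1 + n) (1 + n) k) ⟩
  (1 + n) * (a * ((1 + n) ^ k * (1 + n) ^ k))
    ≡⟨ ring₃ (1 + n) a ((1 + n) ^ k) ⟩
  a * ((1 + n) ^ (3 + n) * (1 + n) ^ k) ∎)
  where
  open ≤-Reasoning
  k a : ℕ
  k = 2 + n
  a = (2 + n) * n
  ring₁ : ∀ n x → (2 + n) * n * ((2 + n) * x) + (2 + n) * x ≡ (1 + n) * (x * ((2 + n) * n + (2 + n)))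
  ring₁ = solve-∀
  ring₂ : ∀ n → 1 + (2 + n) * n ≡ (1 + n) * (1 + n)
  ring₂ = solve-∀
  ring₃ : ∀ m a x → m * (a * (x * x)) ≡ a * (m * x * x)
  ring₃ = solve-∀

[1+1/n]^[n+2]-bound : ∀ b c n₀ .{{_ : NonZero n₀}} → b * (1 + n₀) ^ (2 + n₀) ≤ c * n₀ ^ (2 + n₀) →
  ∀ i → b * (1 + (i + n₀)) ^ (2 + (i + n₀)) ≤ c * (i + n₀) ^ (2 + (i + n₀))
[1+1/n]^[n+2]-bound b c n₀ base zero    = base
[1+1/n]^[n+2]-bound b c n₀@(suc n₁) base (suc i) = *-cancelʳ-≤ _ _ (n ^ (2 + n)) {{m^n≢0 n (2 + n)}} (begin
  b * (2 + n) ^ (3 + n) * n ^ (2 + n)             ≡⟨ *-assoc b _ _ ⟩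
  b * ((2 + n) ^ (3 + n) * n ^ (2 + n))           ≤⟨ *-monoʳ-≤ b ([1+1/n]^[n+2]-decreasing n) ⟩
  b * ((1 + n) ^ (3 + n) * (1 + n) ^ (2 + n))     ≡⟨ ring₁ b ((1 + n) ^ (3 + n)) ((1 + n) ^ (2 + n)) ⟩
  (1 + n) ^ (3 + n) * (b * (1 + n) ^ (2 + n))     ≤⟨ *-monoʳ-≤ ((1 + n) ^ (3 + n)) ([1+1/n]^[n+2]-bound b c n₀ base i) ⟩
  (1 + n) ^ (3 + n) * (c * n ^ (2 + n))           ≡⟨ ring₂ ((1 + n) ^ (3 + n)) c (n ^ (2 + n)) ⟩
  c * (1 + n) ^ (3 + n) * n ^ (2 + n)             ∎)
  where
  open ≤-Reasoning
  n : ℕ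
  n = i + n₀
  instance
    n≢0 : NonZero n
    n≢0 = >-nonZero (≤-trans (s≤s z≤n) (m≤n+m n₀ i))
  ring₁ : ∀ b x y → b * (x * y) ≡ x * (b * y)
  ring₁ = solve-∀
  ring₂ : ∀ x c y → x * (c * y) ≡ c * x * y
  ring₂ = solve-∀

-- Since `g` is positive, `f 0 + … + f n₀` serves as the constant: it covers the initial values, and
-- `step` preserves any constant from `n₀` on.
eventually-dominated : ∀ n₀ (f g : ℕ → ℕ) → (∀ n → 0 < g n) →
  (∀ i c → f (i + n₀) ≤ c * g (i + n₀) → f (suc (i + n₀)) ≤ c * g (suc (i + n₀))) →
  ∃ λ c → ∀ n → f n ≤ c * g n
eventually-dominated zero f g g>0 step = f 0 , bound
  where
  bound : ∀ n → f n ≤ f 0 * g n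
  bound zero    = m≤m*n (f 0) (g 0) {{>-nonZero (g>0 0)}}
  bound (suc n) = subst (λ m → f (suc m) ≤ f 0 * g (suc m)) (+-identityʳ n)
    (step n (f 0) (subst (λ m → f m ≤ f 0 * g m) (sym (+-identityʳ n)) (bound n)))
eventually-dominated (suc n₀) f g g>0 step
  with eventually-dominated n₀ (f ∘ suc) (g ∘ suc) (g>0 ∘ suc)
    (λ i c → subst (λ m → f m ≤ c * g m → f (suc m) ≤ c * g (suc m)) (+-suc i n₀) (step i c))
... | c , f≤cg = f 0 + c , λ where
  zero    → ≤-trans (m≤m*n (f 0) (g 0) {{>-nonZero (g>0 0)}}) (*-monoˡ-≤ (g 0) (m≤m+n (f 0) c))
  (suc n) → ≤-trans (f≤cg n) (*-monoˡ-≤ (g (suc n)) (m≤n+m c (f 0)))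

-- A ratio test: from `n` to `suc n` the left side gains b q (n + 2)ⁿ⁺³ / (n + 1)ⁿ⁺² and the right
-- side c p (n + 1). By monotonicity one comparison, at `n₀`, settles all larger `n`. The leading
-- factor `suc n` will pay for passing from the sum over m to the maximum.
power-≪-factorial : ∀ b c p q n₀ .{{_ : NonZero c}} .{{_ : NonZero p}} →
  b * q * (2 + n₀) ^ (3 + n₀) ≤ c * p * (1 + n₀) ^ (3 + n₀) →
  ∃ λ d → ∀ n → suc n * (b * suc n) ^ suc n * q ^ n ≤ d * (c ^ suc n * n ! * p ^ n)
power-≪-factorial b c p q n₀ base = proj₁ dominated , λ n → ≤-trans
  (≤-reflexive (cong (_* q ^ n) (trans
    (cong (suc n *_) (^-distribʳ-* b (suc n) (suc n)))
    (ring₀ (suc n) (b ^ suc n) (suc n ^ suc n)))))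
  (proj₂ dominated n)
  where
  open ≤-Reasoning
  f g : ℕ → ℕ
  f n = b ^ suc n * suc n ^ (2 + n) * q ^ n
  g n = c ^ suc n * n ! * p ^ n
  g>0 : ∀ n → 0 < g n
  g>0 n = *-mono-≤ (*-mono-≤ (m^n>0 c (suc n)) (1≤n! n)) (m^n>0 p n)
  ring₀ : ∀ n x y → n * (x * y) ≡ x * (n * y)
  ring₀ = solve-∀
  ring₁ : ∀ b B x q Q n → b * B * x * (q * Q) * n ≡ B * Q * n * (b * q * x)
  ring₁ = solve-∀
  ring₂ : ∀ B Q n c p x → B * Q * n * (c * p * (n * x)) ≡ c * p * n * (B * x * Q) * n
  ring₂ = solve-∀
  ring₃ : ∀ c p n d C F P → c * p * n * (d * (C * F * P)) ≡ d * (c * C * (n * F) * (p * P))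
  ring₃ = solve-∀
  step : ∀ i d → f (i + n₀) ≤ d * g (i + n₀) → f (suc (i + n₀)) ≤ d * g (suc (i + n₀))
  step i d f≤dg = *-cancelʳ-≤ _ _ (suc n) (begin
    b * b ^ suc n * (2 + n) ^ (3 + n) * (q * q ^ n) * suc n
      ≡⟨ ring₁ b (b ^ suc n) ((2 + n) ^ (3 + n)) q (q ^ n) (suc n) ⟩
    b ^ suc n * q ^ n * suc n * (b * q * (2 + n) ^ (3 + n))
      ≤⟨ *-monoʳ-≤ (b ^ suc n * q ^ n * suc n) ratio ⟩
    b ^ suc n * q ^ n * suc n * (c * p * (suc n * suc n ^ (2 + n)))
      ≡⟨ ring₂ (b ^ suc n) (q ^ n) (suc n) c p (suc n ^ (2 + n)) ⟩
    c * p * suc n * f n * suc n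
      ≤⟨ *-monoˡ-≤ (suc n) (*-monoʳ-≤ (c * p * suc n) f≤dg) ⟩
    c * p * suc n * (d * g n) * suc n
      ≡⟨ cong (_* suc n) (ring₃ c p (suc n) d (c ^ suc n) (n !) (p ^ n)) ⟩
    d * g (suc n) * suc n ∎)
    where
    n : ℕ
    n = i + n₀
    ratio : b * q * (2 + n) ^ (3 + n) ≤ c * p * suc n ^ (3 + n)
    ratio = subst (λ m → b * q * (1 + m) ^ (2 + m) ≤ c * p * m ^ (2 + m)) (+-suc i n₀)
      ([1+1/n]^[n+2]-bound (b * q) (c * p) (suc n₀) base i)
  dominated : ∃ λ d → ∀ n → f n ≤ d * g n
  dominated = eventually-dominated n₀ f g g>0 step

-- Counting rankings

-- `allVecs` lists words tail by tail, whereas `covering` recurses on the first letter; this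
-- exchanges the two orders of counting.
length-filter-∷ : ∀ {k n} {P : Vec (Fin k) (suc n) → Set} (P? : ∀ v → Dec (P v)) xs vs →
  length (filter P? (concatMap (λ v → map (_∷ v) xs) vs)) ≡ sum (map (λ x → length (filter (P? ∘ (x ∷_)) vs)) xs)
length-filter-∷ P? xs []       = sym (zeros xs)
  where
  zeros : ∀ xs → sum (map (λ _ → 0) xs) ≡ 0
  zeros []       = refl
  zeros (_ ∷ xs) = zeros xs
length-filter-∷ {P = P} P? xs (v ∷ vs) = begin
  length (filter P? (map (_∷ v) xs ++ rest))
    ≡⟨ cong length (filter-++ P? (map (_∷ v) xs) rest) ⟩
  length (filter P? (map (_∷ v) xs) ++ filter P? rest)
    ≡⟨ length-++ (filter P? (map (_∷ v) xs)) ⟩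
  length (filter P? (map (_∷ v) xs)) + length (filter P? rest)
    ≡⟨ cong (length (filter P? (map (_∷ v) xs)) +_) (length-filter-∷ P? xs vs) ⟩
  length (filter P? (map (_∷ v) xs)) + sum (map (λ x → length (filter (P? ∘ (x ∷_)) vs)) xs)
    ≡⟨ split xs ⟩
  sum (map (λ x → length (filter (P? ∘ (x ∷_)) (v ∷ vs))) xs) ∎
  where
  open ≡-Reasoning
  rest = concatMap (λ v → map (_∷ v) xs) vs
  ring : ∀ a b c → a + (b + c) ≡ b + (a + c)
  ring = solve-∀
  tails : Fin _ → ℕ
  tails x = length (filter (P? ∘ (x ∷_)) vs)
  split : ∀ xs → length (filter P? (map (_∷ v) xs)) + sum (map tails xs)
    ≡ sum (map (λ x → length (filter (P? ∘ (x ∷_)) (v ∷ vs))) xs)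
  split []       = refl
  split (x ∷ xs) with P? (x ∷ v)
  ... | yes _ = cong suc (trans (ring (length (filter P? (map (_∷ v) xs))) (tails x) (sum (map tails xs))) (cong (tails x +_) (split xs)))
  ... | no  _ = trans (ring (length (filter P? (map (_∷ v) xs))) (tails x) (sum (map tails xs))) (cong (tails x +_) (split xs))

-- Deleting a letter of `S` makes it free, and deleting any other changes nothing: this is the
-- recurrence of `covering`. An arbitrary `G` lets the induction on `S` shift either argument.
sum-tabulate-delete : ∀ {k} (S : Subset k) (G : ℕ → ℕ → ℕ) →
  sum (tabulate λ a → G ∣ ∁ (S [ a ]≔ outside) ∣ ∣ S [ a ]≔ outside ∣) ≡ ∣ S ∣ * G (suc ∣ ∁ S ∣) (pred ∣ S ∣) + ∣ ∁ S ∣ * G ∣ ∁ S ∣ ∣ S ∣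
sum-tabulate-delete []            G = refl
sum-tabulate-delete (inside  ∷ S) G rewrite sum-tabulate-delete S (λ f j → G f (suc j)) =
  trans (cong (λ x → G (suc ∣ ∁ S ∣) ∣ S ∣ + (x + rest)) (lemma ∣ S ∣))
    (sym (+-assoc (G (suc ∣ ∁ S ∣) ∣ S ∣) (∣ S ∣ * G (suc ∣ ∁ S ∣) ∣ S ∣) rest))
  where
  rest : ℕ
  rest = ∣ ∁ S ∣ * G ∣ ∁ S ∣ (suc ∣ S ∣)
  -- `suc (pred j)` differs from `j` only at 0, where the factor `j` vanishes.
  lemma : ∀ j → j * G (suc ∣ ∁ S ∣) (suc (pred j)) ≡ j * G (suc ∣ ∁ S ∣) j
  lemma zero    = refl
  lemma (suc j) = refl
sum-tabulate-delete (outside ∷ S) G rewrite sum-tabulate-delete S (λ f j → G (suc f) j) =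
  ring (G (suc ∣ ∁ S ∣) ∣ S ∣) (∣ S ∣ * G (suc (suc ∣ ∁ S ∣)) (pred ∣ S ∣)) _
  where
  ring : ∀ a b c → a + (b + c) ≡ b + (a + c)
  ring = solve-∀

sum-tabulate-mono : ∀ {k} {f g : Fin k → ℕ} → (∀ a → f a ≤ g a) → sum (tabulate f) ≤ sum (tabulate g)
sum-tabulate-mono {zero}  f≤g = z≤n
sum-tabulate-mono {suc k} f≤g = +-mono-≤ (f≤g zero) (sum-tabulate-mono (f≤g ∘ suc))

Covers : ∀ {k n} → Subset k → Vec (Fin k) n → Set
Covers S v = ∀ {a} → a ∈ S → ∃ λ i → lookup v i ≡ a

Covers-∷ : ∀ {k n} {S : Subset k} x {v : Vec (Fin k) n} → Covers (S [ x ]≔ outside) v → Covers S (x ∷ v)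
Covers-∷ {S = S} x cov {a} a∈S with a ≟ᶠ x
... | yes refl = zero , refl
... | no  a≢x  with cov ([]≔-minimal S a x a≢x a∈S)
...   | i , vᵢ≡a = suc i , vᵢ≡a

-- Once the first letter `a` is written it is no longer obligatory, so the tail has to cover
-- `S [ a ]≔ outside`. Any decidable `P` implied by covering is allowed, so that the induction can
-- pass to `P? ∘ (a ∷_)`.
covering-≤-count : ∀ {k} n (S : Subset k) {P : Vec (Fin k) n → Set} (P? : ∀ v → Dec (P v)) →
  (∀ v → Covers S v → P v) → covering ∣ ∁ S ∣ ∣ S ∣ n ≤ length (filter P? (allVecs k n))
covering-≤-count zero S P? P-holds with P? []
... | yes _  = base ∣ S ∣
  where
  base : ∀ j → 0 ^ j ≤ 1
  base zero    = s≤s z≤n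
  base (suc j) = z≤n
... | no ¬P  with ∣ S ∣ in eq
...   | suc _ = z≤n
-- The empty word covers `S` vacuously, as any `a ∈ S` would force `0 < ∣ S ∣`.
...   | zero  = contradiction (P-holds [] λ {a} a∈S → contradiction (subst (0 <_) eq (≤-trans (s≤s z≤n) (x∈p⇒∣p-x∣<∣p∣ a∈S))) λ ()) ¬P
covering-≤-count {k} (suc n) S P? P-holds = begin
  ∣ S ∣ * covering (suc ∣ ∁ S ∣) (pred ∣ S ∣) n + ∣ ∁ S ∣ * covering ∣ ∁ S ∣ ∣ S ∣ n
    ≡⟨ sum-tabulate-delete S (λ f j → covering f j n) ⟨
  sum (tabulate λ a → covering ∣ ∁ (S [ a ]≔ outside) ∣ ∣ S [ a ]≔ outside ∣ n)
    ≤⟨ sum-tabulate-mono (λ a → covering-≤-count n (S [ a ]≔ outside) (P? ∘ (a ∷_)) λ v cov → P-holds (a ∷ v) (Covers-∷ a cov)) ⟩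
  sum (tabulate λ a → length (filter (P? ∘ (a ∷_)) (allVecs k n)))
    ≡⟨ cong sum (map-tabulate (λ a → a) λ a → length (filter (P? ∘ (a ∷_)) (allVecs k n))) ⟨
  sum (map (λ a → length (filter (P? ∘ (a ∷_)) (allVecs k n))) (allFin k))
    ≡⟨ length-filter-∷ P? (allFin k) (allVecs k n) ⟨
  length (filter P? (allVecs k (suc n))) ∎
  where open ≤-Reasoning

alternating : Bool → ∀ k → Subset k
alternating b zero    = []
alternating b (suc k) = b ∷ alternating (not b) k

odds : ∀ k → Subset k
odds = alternating outside

∣odds∣ : ∀ m → ∣ odds (2 * m) ∣ ≡ m
∣odds∣ zero    = refl
∣odds∣ (suc m) rewrite +-suc m (m + 0) = cong suc (∣odds∣ m)

∣∁odds∣ : ∀ m → ∣ ∁ (odds (2 * m)) ∣ ≡ m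
∣∁odds∣ zero    = refl
∣∁odds∣ (suc m) rewrite +-suc m (m + 0) = cong suc (∣∁odds∣ m)

∈-odds : ∀ {k} (a : Fin k) j → toℕ a ≡ suc (2 * j) → a ∈ odds k
∈-odds (suc zero)    zero    refl = there here
∈-odds (suc (suc a)) (suc j) eq   =
  there (there (∈-odds a j (trans (suc-injective (suc-injective eq)) (+-suc j (j + 0)))))

-- A ranking is a word over its `2 * m` values: the m odd ones are the obligatory letters, the m
-- even ones the free letters.
covering-≤-L₂ : ∀ m n → covering m m n ≤ L₂ (suc n) m
covering-≤-L₂ m n = subst₂ (λ f j → covering f j n ≤ L₂ (suc n) m) (∣∁odds∣ m) (∣odds∣ m)
  (covering-≤-count n (odds (2 * m)) (isQRanking? m) ranking)
  where
  ranking : ∀ v → Covers (odds (2 * m)) v → IsQRanking m v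
  ranking v cov j = proj₁ hit , trans (cong toℕ (proj₂ hit)) (toℕ-fromℕ< 2j+1<2m)
    where
    2j+1<2m : suc (2 * toℕ j) < 2 * m
    2j+1<2m = ≤-trans (≤-reflexive (sym (*-suc 2 (toℕ j)))) (*-monoʳ-≤ 2 (toℕ<n j))
    hit : ∃ λ i → lookup v i ≡ fromℕ< 2j+1<2m
    hit = cov (∈-odds (fromℕ< 2j+1<2m) (toℕ j) (toℕ-fromℕ< 2j+1<2m))

-- From the sum to the maximum over m

L₂-≤-L : ∀ n {m} → m < n → L₂ (suc n) (suc m) ≤ L (suc n)
-- `drop 1 (upTo (suc n))` computes to `applyUpTo suc n`.
L₂-≤-L n m<n = ≤-foldr-⊔ (∈-map⁺ (L₂ (suc n)) (∈-applyUpTo⁺ suc m<n))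
  where
  ≤-foldr-⊔ : ∀ {x xs} → x ∈ˡ xs → x ≤ foldr _⊔_ 0 xs
  ≤-foldr-⊔ (here refl)          = m≤m⊔n _ _
  ≤-foldr-⊔ {xs = y ∷ _} (there x∈xs) = ≤-trans (≤-foldr-⊔ x∈xs) (m≤n⊔m y _)

-- The summand m = 0 vanishes on nonempty words, and each of the other `1 + n` is at most the
-- maximum. The factor is rounded up to `2 + n`, the argument of `L`, to cancel later.
∑-covering-≤-L : ∀ n → ∑-covering (2 + n) (1 + n) ≤ (2 + n) * L (2 + n)
∑-covering-≤-L n = ≤-trans
  (∑-mono (suc n) λ m m<1+n → ≤-trans (covering-≤-L₂ (suc m) (suc n)) (L₂-≤-L (suc n) m<1+n))
  (≤-trans (≤-reflexive (∑-const (suc n) (L (2 + n)))) (m≤n+m (suc n * L (2 + n)) (L (2 + n))))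
  where
  ∑-const : ∀ n c → ∑ n (λ _ → c) ≡ n * c
  ∑-const zero    c = refl
  ∑-const (suc n) c = cong (c +_) (∑-const n c)

-- Here b / c is the growth constant, q / p the point at which the Taylor polynomial of degree `K`
-- is evaluated, and `n₀` the threshold of the ratio test. With these as variables, numerals enter
-- only through the two hypotheses.
L-growth : ∀ b c p q K n₀ .{{_ : NonZero c}} .{{_ : NonZero p}} .{{_ : NonZero q}} →
  K ! * p ^ K ≤ ∑ (suc K) (scaledTerm p q K) →
  b * q * (2 + n₀) ^ (3 + n₀) ≤ c * p * (1 + n₀) ^ (3 + n₀) →
  ∃ λ d → 0 < d × (∀ n → 1 < n → (b * n) ^ n ≤ d * (c ^ n * L n))
L-growth b c p q K n₀ series≥1 base = suc d * p ^ K , *-mono-≤ {1} {suc d} (s≤s z≤n) (m^n>0 p K) , bound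
  where
  open ≤-Reasoning
  factorial-bound : ∃ λ d → ∀ n → suc n * (b * suc n) ^ suc n * q ^ n ≤ d * (c ^ suc n * n ! * p ^ n)
  factorial-bound = power-≪-factorial b c p q n₀ base
  d : ℕ
  d = proj₁ factorial-bound
  bound : ∀ n → 1 < n → (b * n) ^ n ≤ suc d * p ^ K * (c ^ n * L n)
  bound (suc zero)        (s≤s ())
  -- Words have length `N`, one less than `n`. The cancelled factor joins the loss `n` from the
  -- maximum to the denominator `q ^ N`.
  bound n@(suc N@(suc _)) _        = *-cancelʳ-≤ _ _ (n * q ^ N) {{m*n≢0 n (q ^ N) {{_}} {{m^n≢0 q N}}}} (begin
    (b * n) ^ n * (n * q ^ N)
      ≡⟨ ring₁ ((b * n) ^ n) n (q ^ N) ⟩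
    n * (b * n) ^ n * q ^ N
      ≤⟨ proj₂ factorial-bound N ⟩
    d * (c ^ n * N ! * p ^ N)
      ≤⟨ *-monoˡ-≤ (c ^ n * N ! * p ^ N) (n≤1+n d) ⟩
    suc d * (c ^ n * N ! * p ^ N)
      ≡⟨ ring₂ (suc d) (c ^ n) (N !) (p ^ N) ⟩
    suc d * c ^ n * (p ^ N * N !)
      ≤⟨ *-monoʳ-≤ (suc d * c ^ n) (∑-covering-growth p q K series≥1 N ≤-refl) ⟩
    suc d * c ^ n * (p ^ K * (q ^ N * ∑-covering n N))
      ≤⟨ *-monoʳ-≤ (suc d * c ^ n) (*-monoʳ-≤ (p ^ K) (*-monoʳ-≤ (q ^ N) (∑-covering-≤-L (pred N)))) ⟩
    suc d * c ^ n * (p ^ K * (q ^ N * (n * L n)))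
      ≡⟨ ring₃ (suc d) (c ^ n) (p ^ K) (q ^ N) n (L n) ⟩
    suc d * p ^ K * (c ^ n * L n) * (n * q ^ N) ∎)
    where
    ring₁ : ∀ x n y → x * (n * y) ≡ n * x * y
    ring₁ = solve-∀
    ring₂ : ∀ d c f p → d * (c * f * p) ≡ d * c * (p * f)
    ring₂ = solve-∀
    ring₃ : ∀ d c e q n l → d * c * (e * (q * (n * l))) ≡ d * e * (c * l) * (n * q)
    ring₃ = solve-∀

0·76-growth : ∃ λ d → 0 < d × (∀ n → 1 < n → (76 * n) ^ n ≤ d * (100 ^ n * L n))
-- Both numerical hypotheses are decided by evaluation; the second amounts to (602/601)⁶⁰³ ≤
-- 2900/1064.
0·76-growth = L-growth 76 100 29 14 5 600 (≤ᵇ⇒≤ _ _ tt) (≤ᵇ⇒≤ _ _ tt)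

-- The constant c is the fraction p / q, and 0.76 is 76 / 100, with denominators cleared.
theoremA3 : Σ ℕ λ p → Σ ℕ λ q → (0 < p) × (0 < q) ×
    ((n : ℕ) → 1 < n → p * (76 * n) ^ n ≤ q * (100 ^ n * L n))
theoremA3 = 1 , proj₁ 0·76-growth , s≤s z≤n , proj₁ (proj₂ 0·76-growth) ,
  λ n 1<n → ≤-trans (≤-reflexive (*-identityˡ ((76 * n) ^ n))) (proj₂ (proj₂ 0·76-growth) n 1<n)
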